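{- Let $\alpha$ be a real number with $0\le\alpha\le 1$. Then there exists a set $A=\{a_i : i\in\mathbb{N}\}\subseteq\mathbb{N}$ with $a_i<a_{i+1}$ for all $i\in\mathbb{N}$, $d(A)=\alpha$ and $\liminf_{n\to\infty}\frac{a_{n+1}}{a_n}=1$, such that there is no additive complement of $A$ in the complement of $A$.
   Context: $\mathbb{N}=\{1,2,3,\dots\}$ is the set of natural numbers. For $A,B\subseteq\mathbb{N}$, $A+B:=\{x+y: x\in A,\ y\in B\}$. A set $B\subseteq\mathbb{N}$ is an additive complement of $A\subseteq\mathbb{N}$ if $\mathbb{N}\setminus(A+B)$ is a finite set. A set $B\subseteq\mathbb{N}$ is an additive complement of $A$ in the complement of $A$ if $B$ is an additive complement of $A$ and $B\cap A=\varnothing$. The density of $A\subseteq\mathbb{N}$ is $d(A)=\lim_{n\to\infty}\frac{|A\cap\{1,\dots,n\}|}{n}$ when this limit exists (i.e. when the corresponding limsup and liminf coincide); the equation $d(A)=\alpha$ includes the assertion that the limit exists. -}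

module Defs where

open import Level using (0ℓ)
open import Data.Nat.Base as ℕ using (ℕ; zero; suc; z≤n; s≤s)
import Data.Nat.Properties as ℕ
open import Data.Integer.Base using (+_)
open import Data.Rational.Unnormalised.Base as ℚ using (ℚᵘ; 0ℚᵘ; 1ℚᵘ; _/_; _+_; _-_; ∣_∣)
import Data.Rational.Unnormalised.Properties as ℚ
open import Data.List.Base using (List; length; filter; map; upTo)
import Data.List.Membership.Propositional as List
open import Data.Product.Base using (_×_; _,_; ∃; ∃-syntax; ∃₂)
open import Relation.Binary.PropositionalEquality.Core using (_≡_; refl)
open import Relation.Nullary.Decidable using (map′)
open import Relation.Nullary.Negation using (¬_)
open import Relation.Unary using (Pred; Decidable; _∈_; _⊆_; _∖_; _⊥_)

-- Real numbers, as regular Cauchy sequences of rationals (Bishop).  The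
-- n-th approximation is within 1/(n+1) of the real it represents.
record ℝ : Set where
  constructor mkℝ
  field
    approx  : ℕ → ℚᵘ
    regular : ∀ m n → ∣ approx m - approx n ∣ ℚ.≤ (+ 1 / suc m) + (+ 1 / suc n)

open ℝ public

infix 4 _<ᴿ_ _≤ᴿ_

_<ᴿ_ : ℝ → ℝ → Set
x <ᴿ y = ∃[ n ] approx x n + (+ 2 / suc n) ℚ.< approx y n

_≤ᴿ_ : ℝ → ℝ → Set
x ≤ᴿ y = ¬ (y <ᴿ x)

private
  const-regular : ∀ q m n → ∣ q - q ∣ ℚ.≤ (+ 1 / suc m) + (+ 1 / suc n)
  const-regular q m n =
    ℚ.≤-respˡ-≃ (ℚ.≃-sym (ℚ.∣-∣-cong (ℚ.+-inverseʳ q)))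
      (ℚ.nonNegative⁻¹ ((+ 1 / suc m) + (+ 1 / suc n)))

fromℚ : ℚᵘ → ℝ
fromℚ q = mkℝ (λ _ → q) (const-regular q)

0ℝ 1ℝ : ℝ
0ℝ = fromℚ 0ℚᵘ
1ℝ = fromℚ 1ℚᵘ

-- The two inequalities say ∣ u n - x ∣ < ε.
_⟶_ : (ℕ → ℚᵘ) → ℝ → Set
u ⟶ x = ∀ ε → 0ℚᵘ ℚ.< ε → ∃[ N ] ∀ n → N ℕ.≤ n →
  fromℚ (u n - ε) <ᴿ x × x <ᴿ fromℚ (u n + ε)

-- "Greatest lower bound" and "least upper bound" in the constructively
-- strong form: anything beyond the bound is beaten by an actual value.
IsInf : (ℕ → ℝ) → ℝ → Set
IsInf f m = (∀ i → m ≤ᴿ f i) × (∀ y → m <ᴿ y → ∃[ i ] f i <ᴿ y)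

IsSup : (ℕ → ℝ) → ℝ → Set
IsSup f m = (∀ i → f i ≤ᴿ m) × (∀ y → y <ᴿ m → ∃[ i ] y <ᴿ f i)

-- liminf u = sup_N inf_{n ≥ N} u n
IsLimInf : (ℕ → ℚᵘ) → ℝ → Set
IsLimInf u ℓ = ∃[ m ]
  (∀ N → IsInf (λ k → fromℚ (u (N ℕ.+ k))) (m N)) × IsSup m ℓ

-- Sets of natural numbers.  Here 0 is not a natural number, so subsets
-- are predicates on ℕ that are contained in ℕ⁺.
ℕ⁺ : Pred ℕ 0ℓ
ℕ⁺ n = 0 ℕ.< n

_⊕_ : Pred ℕ 0ℓ → Pred ℕ 0ℓ → Pred ℕ 0ℓ
(A ⊕ B) n = ∃₂ λ x y → x ∈ A × y ∈ B × x ℕ.+ y ≡ n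

Finite : Pred ℕ 0ℓ → Set
Finite P = ∃[ xs ] (∀ n → n ∈ P → n List.∈ xs)

IsAdditiveComplement : Pred ℕ 0ℓ → Pred ℕ 0ℓ → Set
IsAdditiveComplement A B = B ⊆ ℕ⁺ × Finite (ℕ⁺ ∖ (A ⊕ B))

IsAdditiveComplementInComplement : Pred ℕ 0ℓ → Pred ℕ 0ℓ → Set
IsAdditiveComplementInComplement A B = IsAdditiveComplement A B × B ⊥ A

-- ∣ A ∩ {1,…,n} ∣
count : {A : Pred ℕ 0ℓ} → Decidable A → ℕ → ℕ
count A? n = length (filter A? (map suc (upTo n)))

-- The quotients are indexed from n + 1 so that the denominator is nonzero.
HasDensity : {A : Pred ℕ 0ℓ} → Decidable A → ℝ → Set
HasDensity A? α = (λ n → + count A? (suc n) / suc n) ⟶ α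

-- Below, a set is given by its increasing enumeration a₁ < a₂ < …, with
-- aᵢ represented by a (i - 1).

AllPositive : (ℕ → ℕ) → Set
AllPositive a = ∀ i → 0 ℕ.< a i

StrictlyIncreasing : (ℕ → ℕ) → Set
StrictlyIncreasing a = ∀ i → a i ℕ.< a (suc i)

Range : (ℕ → ℕ) → Pred ℕ 0ℓ
Range a n = ∃[ i ] a i ≡ n

index≤term : ∀ {a} → StrictlyIncreasing a → ∀ i → i ℕ.≤ a i
index≤term inc zero    = z≤n
index≤term inc (suc i) = ℕ.≤-<-trans (index≤term inc i) (inc i)

range? : ∀ {a} → StrictlyIncreasing a → Decidable (Range a)
range? {a} inc n =
  map′ (λ { (i , _ , eq) → i , eq })
       (λ { (i , refl) → i , s≤s (index≤term inc i) , refl })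
       (ℕ.anyUpTo? (λ i → a i ℕ.≟ n) (suc n))

ratio : ∀ a → AllPositive a → ℕ → ℚᵘ
ratio a pos n = _/_ (+ a (suc n)) (a n) {{ℕ.>-nonZero (pos n)}}

{-# OPTIONS --safe #-}

-- If A ∩ {1,…,n-1} is symmetric under x ↦ n - x, then a sum a + b = n with
-- a ∈ A forces b ∈ A, so n ∉ A + B for every B disjoint from A.  It is
-- therefore enough that A be symmetric in this sense for infinitely many n.
-- Starting from a greedy set with about α x elements up to x, reflect it
-- successively about m = 64ᵏ, k = 0, 1, 2, …, each time adding the twins 2m
-- and 2m+1, which make the liminf of the ratios 1.  Each reflection
-- multiplies the bound on the counting error by at most 8, so up to x = 64ᵏ the
-- error is O(8ᵏ) = O(√x) and the density stays α.
module Submission where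

open import Defs
open import Data.Nat.Base using (ℕ)
open import Data.Product.Base using (Σ-syntax; _×_)
open import Level using (0ℓ)
open import Relation.Nullary.Negation using (¬_)
open import Relation.Unary using (Pred)

open import Data.Bool.Base using (Bool; true; false; if_then_else_; _∨_)
open import Data.List.Base using ([]; _∷_; _∷ʳ_; _++_; length; filter; map; upTo)
open import Data.List.Extrema.Nat using (max; xs≤max)
open import Data.List.Properties using (upTo-∷ʳ; map-++; filter-++; length-++)
open import Data.List.Relation.Unary.All using (lookup)
open import Data.Nat.Base as ℕ using (zero; suc; z≤n; s≤s; z<s)
import Data.Nat.Properties as ℕ
open import Data.Nat.Tactic.RingSolver using (solve-∀)
open import Data.Product.Base using (_,_; ∃; ∃-syntax; proj₁; proj₂)
open import Data.Sum.Base using (inj₁; inj₂)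
open import Relation.Binary.PropositionalEquality using (_≡_; refl; sym; trans; cong; cong₂; subst; module ≡-Reasoning)
open import Relation.Nullary.Decidable using (does; yes; no; dec-true; dec-false)
open import Relation.Nullary.Negation using (contradiction)
open import Relation.Unary using (Decidable)

-- The combinatorial construction

module _ where

  open import Data.Nat.Base
  open import Data.Nat.Properties

  -- Distances and nearly additive functions

  dist-≤ : ∀ {u v k} → u ≤ v + k → v ≤ u + k → ∣ u - v ∣ ≤ k
  dist-≤ {u} {v} {k} u≤v+k v≤u+k with ≤-total u v
  ... | inj₁ u≤v = ≤-trans (≤-reflexive (m≤n⇒∣m-n∣≡n∸m u≤v)) (m≤n+o⇒m∸n≤o v u v≤u+k)
  ... | inj₂ v≤u = ≤-trans (≤-reflexive (m≤n⇒∣n-m∣≡n∸m v≤u)) (m≤n+o⇒m∸n≤o u v u≤v+k)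

  dist-+ : ∀ u u′ v v′ → ∣ u + u′ - v + v′ ∣ ≤ ∣ u - v ∣ + ∣ u′ - v′ ∣
  dist-+ u u′ v v′ = begin
    ∣ u + u′ - v + v′ ∣                       ≤⟨ ∣-∣-triangle (u + u′) (v + u′) (v + v′) ⟩
    ∣ u + u′ - v + u′ ∣ + ∣ v + u′ - v + v′ ∣ ≡⟨ cong₂ _+_ (∣m+o-n+o∣≡∣m-n∣ u v u′) (∣m+n-m+o∣≡∣n-o∣ v u′ v′) ⟩
    ∣ u - v ∣ + ∣ u′ - v′ ∣                   ∎
    where
    open ≤-Reasoning
    ∣m+o-n+o∣≡∣m-n∣ : ∀ m n o → ∣ m + o - n + o ∣ ≡ ∣ m - n ∣
    ∣m+o-n+o∣≡∣m-n∣ m n o rewrite +-comm m o | +-comm n o = ∣m+n-m+o∣≡∣n-o∣ o m n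

  dist-cancel : ∀ u v w w′ → ∣ u - v ∣ ≤ ∣ u + w - v + w′ ∣ + ∣ w - w′ ∣
  dist-cancel u v w w′ = begin
    ∣ u - v ∣                                 ≡⟨ ∣m+n-m+o∣≡∣n-o∣ w u v ⟨
    ∣ w + u - w + v ∣                         ≡⟨ cong₂ ∣_-_∣ (+-comm w u) (+-comm w v) ⟩
    ∣ u + w - v + w ∣                         ≤⟨ ∣-∣-triangle (u + w) (v + w′) (v + w) ⟩
    ∣ u + w - v + w′ ∣ + ∣ v + w′ - v + w ∣   ≡⟨ cong (∣ u + w - v + w′ ∣ +_) (trans (∣m+n-m+o∣≡∣n-o∣ v w′ w) (∣-∣-comm w′ w)) ⟩
    ∣ u + w - v + w′ ∣ + ∣ w - w′ ∣           ∎
    where open ≤-Reasoning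

  NearlyAdditive : ℕ → (ℕ → ℕ) → Set
  NearlyAdditive κ f = ∀ x y → ∣ f (x + y) - f x + f y ∣ ≤ κ

  -- Divided by `x * y` this reads f(x)/x ≤ f(y)/y + κ(1/x + 1/y): the regularity of a Bishop real,
  -- with the denominators cleared so that it stays within natural numbers.
  QuasiLinear : ℕ → (ℕ → ℕ) → Set
  QuasiLinear κ f = ∀ x y → y * f x ≤ x * f y + κ * (x + y)

  -- Both `f x` and `f y` are compared with `f z` at `z = x + y`. After multiplication by `z` the
  -- errors add up to κ(z + x) + κ(z + y) = 3κz, and `z` cancels; the case `z = 0` rests on
  -- `f 0 ≡ 0`.
  quasiLinear⇒nearlyAdditive : ∀ {κ f} → f 0 ≡ 0 → QuasiLinear κ f → NearlyAdditive (3 * κ) f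
  quasiLinear⇒nearlyAdditive {κ} {f} f0≡0 ql x y with x + y in x+y≡z
  ... | zero rewrite m+n≡0⇒m≡0 x x+y≡z | m+n≡0⇒n≡0 x x+y≡z | f0≡0 = z≤n
  ... | z@(suc _) = dist-≤ (*-cancelˡ-≤ z upper) (*-cancelˡ-≤ z lower)
    where
    open ≤-Reasoning
    collect : ∀ z u κ → z * u + κ * (z + z + z) ≡ z * (u + 3 * κ)
    collect = solve-∀
    upper : z * f z ≤ z * (f x + f y + 3 * κ)
    upper = begin
      z * f z                                   ≡⟨ cong (_* f z) x+y≡z ⟨
      (x + y) * f z                             ≡⟨ *-distribʳ-+ (f z) x y ⟩
      x * f z + y * f z                         ≤⟨ +-mono-≤ (ql z x) (ql z y) ⟩
      (z * f x + κ * (z + x)) + (z * f y + κ * (z + y)) ≡⟨ regroup z (f x) (f y) κ x y ⟩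
      z * (f x + f y) + κ * (z + z + (x + y))   ≡⟨ cong (λ w → z * (f x + f y) + κ * (z + z + w)) x+y≡z ⟩
      z * (f x + f y) + κ * (z + z + z)         ≡⟨ collect z (f x + f y) κ ⟩
      z * (f x + f y + 3 * κ)                   ∎
      where
      regroup : ∀ z u v κ x y → (z * u + κ * (z + x)) + (z * v + κ * (z + y)) ≡ z * (u + v) + κ * (z + z + (x + y))
      regroup = solve-∀
    lower : z * (f x + f y) ≤ z * (f z + 3 * κ)
    lower = begin
      z * (f x + f y)                           ≡⟨ *-distribˡ-+ z (f x) (f y) ⟩
      z * f x + z * f y                         ≤⟨ +-mono-≤ (ql x z) (ql y z) ⟩
      (x * f z + κ * (x + z)) + (y * f z + κ * (y + z)) ≡⟨ regroup z (f z) κ x y ⟩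
      (x + y) * f z + κ * (z + z + (x + y))     ≡⟨ cong (λ w → w * f z + κ * (z + z + w)) x+y≡z ⟩
      z * f z + κ * (z + z + z)                 ≡⟨ collect z (f z) κ ⟩
      z * (f z + 3 * κ)                         ∎
      where
      regroup : ∀ z u κ x y → (x * u + κ * (x + z)) + (y * u + κ * (y + z)) ≡ (x + y) * u + κ * (z + z + (x + y))
      regroup = solve-∀

  -- Counting functions and greedy sets

  bit : Bool → ℕ
  bit b = if b then 1 else 0

  bit≤1 : ∀ b → bit b ≤ 1
  bit≤1 true  = ≤-refl
  bit≤1 false = z≤n

  tally : (ℕ → Bool) → ℕ → ℕ
  tally b zero    = 0
  tally b (suc n) = tally b n + bit (b (suc n))

  tally-cong : ∀ {b c} n → (∀ {x} → 0 < x → x ≤ n → b x ≡ c x) → tally b n ≡ tally c n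
  tally-cong zero    b≗c = refl
  tally-cong (suc n) b≗c =
    cong₂ _+_ (tally-cong n λ 0<x x≤n → b≗c 0<x (m≤n⇒m≤1+n x≤n)) (cong bit (b≗c z<s ≤-refl))

  greedy : (ℕ → ℕ) → ℕ → ℕ
  greedy f zero    = 0
  greedy f (suc x) = greedy f x + bit (does (greedy f x <? f (suc x)))

  greedyBit : (ℕ → ℕ) → ℕ → Bool
  greedyBit f x = does (greedy f (pred x) <? f x)

  tally-greedyBit : ∀ f n → tally (greedyBit f) n ≡ greedy f n
  tally-greedyBit f zero    = refl
  tally-greedyBit f (suc n) = cong (_+ bit (greedyBit f (suc n))) (tally-greedyBit f n)

  -- The witness y is the last step up to x at which the greedy count increased
  -- (in greedy-lower: did not increase).
  greedy-upper : ∀ f x → ∃[ y ] ∃[ d ] y + d ≡ x × greedy f x ≤ f y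
  greedy-upper f zero = 0 , 0 , refl , z≤n
  greedy-upper f (suc x) with greedy f x <? f (suc x)
  ... | yes g<f rewrite dec-true (greedy f x <? f (suc x)) g<f = suc x , 0 , +-identityʳ (suc x) , subst (_≤ f (suc x)) (+-comm 1 (greedy f x)) g<f
  ... | no  g≮f rewrite dec-false (greedy f x <? f (suc x)) g≮f with greedy-upper f x
  ...   | y , d , refl , g≤f = y , suc d , +-suc y d , ≤-trans (≤-reflexive (+-identityʳ _)) g≤f

  greedy-lower : ∀ f → f 0 ≡ 0 → ∀ x → ∃[ y ] ∃[ d ] y + d ≡ x × f y + d ≤ greedy f x
  greedy-lower f f0 zero = 0 , 0 , refl , ≤-reflexive (trans (+-identityʳ _) f0)
  greedy-lower f f0 (suc x) with greedy f x <? f (suc x)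
  ... | no  g≮f rewrite dec-false (greedy f x <? f (suc x)) g≮f = suc x , 0 , +-identityʳ (suc x) , +-mono-≤ (≮⇒≥ g≮f) z≤n
  ... | yes g<f rewrite dec-true (greedy f x <? f (suc x)) g<f with greedy-lower f f0 x
  ...   | y , d , refl , le = y , suc d , +-suc y d , (begin
    f y + suc d           ≡⟨ +-suc (f y) d ⟩
    suc (f y + d)         ≤⟨ s≤s le ⟩
    suc (greedy f (y + d)) ≡⟨ +-comm 1 _ ⟩
    greedy f (y + d) + 1  ∎)
    where open ≤-Reasoning

  -- Since its last increase the count has stood still, while `f` has dropped by at most κ, because
  -- `f d ≥ 0`. Since its last non-increase the count has gained a full `d`, while `f` has gained at
  -- most `f d + κ ≤ d + κ`.
  greedy-close : ∀ {κ f} → (∀ x → f x ≤ x) → NearlyAdditive κ f →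
                 ∀ x → ∣ greedy f x - f x ∣ ≤ κ
  greedy-close {κ} {f} f≤id add x = dist-≤ upper lower
    where
    open ≤-Reasoning
    upper : greedy f x ≤ f x + κ
    upper with greedy-upper f x
    ... | y , d , refl , g≤f = begin
      greedy f (y + d)                              ≤⟨ g≤f ⟩
      f y                                           ≤⟨ m≤m+n (f y) (f d) ⟩
      f y + f d                                     ≤⟨ m≤n+∣n-m∣ (f y + f d) (f (y + d)) ⟩
      f (y + d) + ∣ f (y + d) - f y + f d ∣         ≤⟨ +-monoʳ-≤ (f (y + d)) (add y d) ⟩
      f (y + d) + κ                                 ∎
    lower : f x ≤ greedy f x + κ
    lower with greedy-lower f (n≤0⇒n≡0 (f≤id 0)) x
    ... | y , d , refl , le = begin
      f (y + d)                                     ≤⟨ m≤n+∣m-n∣ (f (y + d)) (f y + f d) ⟩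
      f y + f d + ∣ f (y + d) - f y + f d ∣         ≤⟨ +-mono-≤ (+-monoʳ-≤ (f y) (f≤id d)) (add y d) ⟩
      f y + d + κ                                   ≤⟨ +-monoˡ-≤ κ le ⟩
      greedy f (y + d) + κ                          ∎

  -- On {1,…,2m-1} the set becomes symmetric about m; it then acquires the twins
  -- 2m and 2m+1, and is unchanged on {1,…,m} and beyond 2m+1.
  reflect : ℕ → (ℕ → Bool) → ℕ → Bool
  reflect m b x = if does (x <? m + m) then b (x ⊓ (m + m ∸ x)) else (does (x ≤? suc (m + m)) ∨ b x)

  -- Symmetry and counting error after one reflection

  module _ (m : ℕ) (b : ℕ → Bool) where

    -- Naming the mirror image `y` instead of writing `m + m ∸ x` reduces the symmetry to
    -- commutativity of `⊓`. The condition `0 < y` keeps `x` below the twins.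
    reflect-inside : ∀ {x y} → x + y ≡ m + m → 0 < y → reflect m b x ≡ b (x ⊓ y)
    reflect-inside {x} {y} x+y≡2m 0<y
      rewrite sym x+y≡2m | dec-true (x <? x + y) (m<m+n x 0<y) | m+n∸m≡n x y = refl

    reflect-symmetric : ∀ {x y} → 0 < x → 0 < y → x + y ≡ m + m → reflect m b x ≡ reflect m b y
    reflect-symmetric {x} {y} 0<x 0<y x+y≡2m = begin
      reflect m b x  ≡⟨ reflect-inside x+y≡2m 0<y ⟩
      b (x ⊓ y)      ≡⟨ cong b (⊓-comm x y) ⟩
      b (y ⊓ x)      ≡⟨ reflect-inside (trans (+-comm y x) x+y≡2m) 0<x ⟨
      reflect m b y  ∎
      where open ≡-Reasoning

    reflect-below : ∀ {x} → 0 < x → x ≤ m → reflect m b x ≡ b x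
    reflect-below {x} 0<x x≤m = begin
      reflect m b x          ≡⟨ reflect-inside (m+[n∸m]≡n (≤-trans x≤m (m≤m+n m m))) (<-≤-trans 0<x x≤y) ⟩
      b (x ⊓ (m + m ∸ x))    ≡⟨ cong b (m≤n⇒m⊓n≡m x≤y) ⟩
      b x                    ∎
      where
      open ≡-Reasoning
      x≤y : x ≤ m + m ∸ x
      x≤y = m+n≤o⇒m≤o∸n x (+-mono-≤ x≤m x≤m)

    reflect-pair : ∀ {x} → m + m ≤ x → x ≤ suc (m + m) → reflect m b x ≡ true
    reflect-pair {x} 2m≤x x≤1+2m
      rewrite dec-false (x <? m + m) (≤⇒≯ 2m≤x) | dec-true (x ≤? suc (m + m)) x≤1+2m = refl

    reflect-above : ∀ {x} → suc (m + m) < x → reflect m b x ≡ b x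
    reflect-above {x} 1+2m<x
      rewrite dec-false (x <? m + m) (<⇒≯ (<-trans (n<1+n (m + m)) 1+2m<x))
            | dec-false (x ≤? suc (m + m)) (<⇒≱ 1+2m<x) = refl

    tally-reflect-below : ∀ {x} → x ≤ m → tally (reflect m b) x ≡ tally b x
    tally-reflect-below {x} x≤m = tally-cong x λ 0<y y≤x → reflect-below 0<y (≤-trans y≤x x≤m)

  -- The points `suc p + i` and `suc p ∸ i` have equal bits, so when `d` grows by one the reflected
  -- count gains exactly what `tally b y` loses. The centre `suc p` is its own mirror image, hence
  -- the two different endpoints on the right.
  tally-reflect-mirror : ∀ p b d y → d + y ≡ p →
    tally (reflect (suc p) b) (suc p + d) + tally b y ≡ tally b (suc p) + tally b p
  tally-reflect-mirror p b zero y refl =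
    cong (_+ tally b p) (trans (cong (tally (reflect (suc p) b)) (+-identityʳ (suc p))) (tally-reflect-below (suc p) b ≤-refl))
  tally-reflect-mirror p b (suc d) y d+y≡p = begin
    tally r (suc p + suc d) + tally b y
      ≡⟨ cong (λ x → tally r x + tally b y) (+-suc (suc p) d) ⟩
    tally r (suc p + d) + bit (r (suc (suc p + d))) + tally b y
      ≡⟨ cong (λ v → tally r (suc p + d) + bit v + tally b y) mirrored ⟩
    tally r (suc p + d) + bit (b (suc y)) + tally b y
      ≡⟨ swap (tally r (suc p + d)) _ _ ⟩
    tally r (suc p + d) + tally b (suc y)
      ≡⟨ tally-reflect-mirror p b d (suc y) (trans (+-suc d y) d+y≡p) ⟩
    tally b (suc p) + tally b p ∎
    where
    open ≡-Reasoning
    r = reflect (suc p) b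
    swap : ∀ u v w → u + v + w ≡ u + (w + v)
    swap = solve-∀
    shift : ∀ p d y → suc (suc p + d) + suc y ≡ suc p + suc (suc d + y)
    shift = solve-∀
    mirrored : r (suc (suc p + d)) ≡ b (suc y)
    mirrored = begin
      r (suc (suc p + d)) ≡⟨ reflect-symmetric (suc p) b z<s z<s (trans (shift p d y) (cong (λ q → suc p + suc q) d+y≡p)) ⟩
      r (suc y)           ≡⟨ reflect-below (suc p) b z<s (s≤s (≤-trans (m≤n+m y (suc d)) (≤-reflexive d+y≡p))) ⟩
      b (suc y)           ∎

  module _ {κ f} (add : NearlyAdditive κ f) {s b} (close : ∀ x → ∣ tally b x - f x ∣ ≤ s) 
    {m p} (m≡1+p : m ≡ suc p) where

    private
      r = reflect m b

    -- With `y = p ∸ d`, the mirror identity expresses the new count through the old counts at `m`,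
    -- `p` and `y`, each within `s` of `f`. The same combination of values of `f` is right up to 2κ,
    -- since `f m + f p` and `f (m + d) + f y` are both within κ of `f (m + p)`.
    reflect-close-mirror : ∀ d → d ≤ p → ∣ tally r (m + d) - f (m + d) ∣ ≤ 3 * s + 2 * κ
    reflect-close-mirror d d≤p with p ∸ d | m+[n∸m]≡n d≤p
    ... | y | d+y≡p = begin
      ∣ tally r (m + d) - f (m + d) ∣
        ≤⟨ dist-cancel (tally r (m + d)) (f (m + d)) (tally b y) (f y) ⟩
      ∣ tally r (m + d) + tally b y - f (m + d) + f y ∣ + ∣ tally b y - f y ∣
        ≤⟨ +-mono-≤ (∣-∣-triangle (tally r (m + d) + tally b y) (f m + f p) (f (m + d) + f y)) (close y) ⟩
      ∣ tally r (m + d) + tally b y - f m + f p ∣ + ∣ f m + f p - f (m + d) + f y ∣ + s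
        ≤⟨ +-monoˡ-≤ s (+-mono-≤ both-halves resplit) ⟩
      s + s + (κ + κ) + s
        ≡⟨ total s κ ⟩
      3 * s + 2 * κ ∎
      where
      open ≤-Reasoning
      total : ∀ s κ → s + s + (κ + κ) + s ≡ 3 * s + 2 * κ
      total = solve-∀
      both-halves : ∣ tally r (m + d) + tally b y - f m + f p ∣ ≤ s + s
      both-halves = begin
        ∣ tally r (m + d) + tally b y - f m + f p ∣ ≡⟨ cong (∣_- f m + f p ∣) (mirror m≡1+p) ⟩
        ∣ tally b m + tally b p - f m + f p ∣       ≤⟨ dist-+ (tally b m) (tally b p) (f m) (f p) ⟩
        ∣ tally b m - f m ∣ + ∣ tally b p - f p ∣   ≤⟨ +-mono-≤ (close m) (close p) ⟩
        s + s                                       ∎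
        where
        mirror : m ≡ suc p → tally r (m + d) + tally b y ≡ tally b m + tally b p
        mirror refl = tally-reflect-mirror p b d y d+y≡p
      m+d+y≡m+p : m + d + y ≡ m + p
      m+d+y≡m+p = trans (+-assoc m d y) (cong (m +_) d+y≡p)
      resplit : ∣ f m + f p - f (m + d) + f y ∣ ≤ κ + κ
      resplit = begin
        ∣ f m + f p - f (m + d) + f y ∣
          ≤⟨ ∣-∣-triangle (f m + f p) (f (m + p)) (f (m + d) + f y) ⟩
        ∣ f m + f p - f (m + p) ∣ + ∣ f (m + p) - f (m + d) + f y ∣
          ≡⟨ cong₂ _+_ (∣-∣-comm (f m + f p) (f (m + p)))
                       (cong (λ z → ∣ f z - f (m + d) + f y ∣) (sym m+d+y≡m+p)) ⟩
        ∣ f (m + p) - f m + f p ∣ + ∣ f (m + d + y) - f (m + d) + f y ∣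
          ≤⟨ +-mono-≤ (add m p) (add (m + d) y) ⟩
        κ + κ ∎

    private
      step : ∀ n → ∣ tally r (suc n) - tally b (suc n) ∣ ≤ ∣ tally r n - tally b n ∣ + ∣ bit (r (suc n)) - bit (b (suc n)) ∣
      step n = dist-+ (tally r n) (bit (r (suc n))) (tally b n) (bit (b (suc n)))

      bit-dist≤1 : ∀ u v → ∣ bit u - bit v ∣ ≤ 1
      bit-dist≤1 u v = ≤-trans (∣m-n∣≤m⊔n (bit u) (bit v)) (⊔-lub (bit≤1 u) (bit≤1 v))

      bound₀ = 4 * s + 2 * κ

    -- The last mirrored point is `m + p`, that is 2m-1. Beyond it the old and new sets can differ
    -- only at the twins 2m and 2m+1, which accounts for `2 ⊓ e`; from there on the two counts grow
    -- in step.
    reflect-drift : ∀ e → ∣ tally r (m + p + e) - tally b (m + p + e) ∣ ≤ bound₀ + 2 ⊓ e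
    reflect-drift zero rewrite +-identityʳ (m + p) = begin
      ∣ tally r (m + p) - tally b (m + p) ∣
        ≤⟨ ∣-∣-triangle (tally r (m + p)) (f (m + p)) (tally b (m + p)) ⟩
      ∣ tally r (m + p) - f (m + p) ∣ + ∣ f (m + p) - tally b (m + p) ∣
        ≤⟨ +-mono-≤ (reflect-close-mirror p ≤-refl)
                    (≤-trans (≤-reflexive (∣-∣-comm (f (m + p)) (tally b (m + p)))) (close (m + p))) ⟩
      3 * s + 2 * κ + s
        ≡⟨ total s κ ⟩
      bound₀ + 0 ∎
      where
      open ≤-Reasoning
      total : ∀ s κ → 3 * s + 2 * κ + s ≡ 4 * s + 2 * κ + 0
      total = solve-∀
    reflect-drift (suc e) rewrite +-suc (m + p) e with e <? 2
    ... | yes e<2 = ≤-trans (step n) (≤-trans (+-mono-≤ (reflect-drift e) (bit-dist≤1 (r (suc n)) (b (suc n)))) (small e e<2))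
      where
      n = m + p + e
      small : ∀ e → e < 2 → bound₀ + 2 ⊓ e + 1 ≤ bound₀ + 2 ⊓ suc e
      small 0 _ = ≤-reflexive (+-assoc bound₀ 0 1)
      small 1 _ = ≤-reflexive (+-assoc bound₀ 1 1)
      small (suc (suc _)) (s≤s (s≤s ()))
    ... | no e≮2 = begin
      ∣ tally r (suc n) - tally b (suc n) ∣   ≤⟨ step n ⟩
      ∣ tally r n - tally b n ∣ + ∣ bit (r (suc n)) - bit (b (suc n)) ∣
        ≡⟨ cong (λ v → ∣ tally r n - tally b n ∣ + ∣ bit v - bit (b (suc n)) ∣) (reflect-above m b beyond) ⟩
      ∣ tally r n - tally b n ∣ + ∣ bit (b (suc n)) - bit (b (suc n)) ∣
        ≡⟨ trans (cong (∣ tally r n - tally b n ∣ +_) (∣n-n∣≡0 (bit (b (suc n))))) (+-identityʳ _) ⟩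
      ∣ tally r n - tally b n ∣               ≤⟨ reflect-drift e ⟩
      bound₀ + 2 ⊓ e                          ≤⟨ +-monoʳ-≤ bound₀ (⊓-monoʳ-≤ 2 (n≤1+n e)) ⟩
      bound₀ + 2 ⊓ suc e                      ∎
      where
      open ≤-Reasoning
      n = m + p + e
      beyond : suc (m + m) < suc n
      beyond = s≤s (begin
        suc (m + m)   ≡⟨ trans (cong (λ q → suc (m + q)) m≡1+p) (shift m p) ⟩
        m + p + 2     ≤⟨ +-monoʳ-≤ (m + p) (≮⇒≥ e≮2) ⟩
        n             ∎)
        where
        shift : ∀ m p → suc (m + suc p) ≡ m + p + 2
        shift = solve-∀

    -- Up to `m` nothing changes, up to 2m-1 the mirror estimate applies, and beyond that the drift
    -- is added to the old error. The last range is the worst and sets the constants.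
    reflect-close : ∀ x → ∣ tally r x - f x ∣ ≤ 5 * s + (2 * κ + 2)
    reflect-close x with x ≤? m | x ≤? m + p
    ... | yes x≤m | _ = begin
      ∣ tally r x - f x ∣   ≡⟨ cong (∣_- f x ∣) (tally-reflect-below m b x≤m) ⟩
      ∣ tally b x - f x ∣   ≤⟨ close x ⟩
      s                     ≤⟨ m≤m+n s (4 * s) ⟩
      5 * s                 ≤⟨ m≤m+n (5 * s) _ ⟩
      5 * s + (2 * κ + 2)   ∎
      where open ≤-Reasoning
    ... | no x≰m | yes x≤m+p = begin
      ∣ tally r x - f x ∣   ≡⟨ cong (λ z → ∣ tally r z - f z ∣) (m+[n∸m]≡n (<⇒≤ (≰⇒> x≰m))) ⟨
      ∣ tally r (m + (x ∸ m)) - f (m + (x ∸ m)) ∣ ≤⟨ reflect-close-mirror (x ∸ m) (m≤n+o⇒m∸n≤o x m x≤m+p) ⟩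
      3 * s + 2 * κ         ≤⟨ m≤m+n _ (2 * s + 2) ⟩
      3 * s + 2 * κ + (2 * s + 2) ≡⟨ total s κ ⟩
      5 * s + (2 * κ + 2)   ∎
      where
      open ≤-Reasoning
      total : ∀ s κ → 3 * s + 2 * κ + (2 * s + 2) ≡ 5 * s + (2 * κ + 2)
      total = solve-∀
    ... | no _ | no x≰m+p = begin
      ∣ tally r x - f x ∣                         ≤⟨ ∣-∣-triangle (tally r x) (tally b x) (f x) ⟩
      ∣ tally r x - tally b x ∣ + ∣ tally b x - f x ∣ ≤⟨ +-mono-≤ drift (close x) ⟩
      bound₀ + 2 + s                              ≡⟨ total s κ ⟩
      5 * s + (2 * κ + 2)                         ∎
      where
      open ≤-Reasoning
      total : ∀ s κ → 4 * s + 2 * κ + 2 + s ≡ 5 * s + (2 * κ + 2)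
      total = solve-∀
      drift : ∣ tally r x - tally b x ∣ ≤ bound₀ + 2
      drift = subst (λ z → ∣ tally r z - tally b z ∣ ≤ bound₀ + 2) (m+[n∸m]≡n (<⇒≤ (≰⇒> x≰m+p)))
                (≤-trans (reflect-drift (x ∸ (m + p))) (+-monoʳ-≤ bound₀ (m⊓n≤m 2 _)))

  -- Iterated reflections and their limit

  centre : ℕ → ℕ
  centre k = 64 ^ k

  centre-mono : ∀ {j k} → j ≤ k → centre j ≤ centre k
  centre-mono = ^-monoʳ-≤ 64

  centre>0 : ∀ k → 0 < centre k
  centre>0 k = >-nonZero⁻¹ (centre k) {{m^n≢0 64 k}}

  n<centre : ∀ n → n < centre n
  n<centre zero    = z<s
  n<centre (suc n) = begin-strict
    suc n                 ≤⟨ n<centre n ⟩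
    centre n              <⟨ m<m+n (centre n) (centre>0 n) ⟩
    centre n + centre n   ≤⟨ +-monoʳ-≤ (centre n) (m≤m+n (centre n) (62 * centre n)) ⟩
    centre (suc n)        ∎
    where open ≤-Reasoning

  -- The mirrored block and the twins of one centre do not extend past the next centre, so later
  -- reflections leave them intact.
  2centre<centre : ∀ k → suc (centre k + centre k) ≤ centre (suc k)
  2centre<centre k = begin
    suc (c + c)       ≤⟨ s≤s (m≤m+n (c + c) 0) ⟩
    1 + (c + c + 0)   ≤⟨ +-mono-≤ (centre>0 k) (+-monoʳ-≤ (c + c) z≤n) ⟩
    c + (c + c + 61 * c) ≡⟨ total c ⟩
    centre (suc k)    ∎
    where
    open ≤-Reasoning
    c = centre k
    total : ∀ c → c + (c + c + 61 * c) ≡ 64 * c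
    total = solve-∀

  8^k*8^k≡64^k : ∀ k → 8 ^ k * 8 ^ k ≡ centre k
  8^k*8^k≡64^k zero    = refl
  8^k*8^k≡64^k (suc k) = trans (regroup (8 ^ k)) (cong (64 *_) (8^k*8^k≡64^k k))
    where
    regroup : ∀ e → 8 * e * (8 * e) ≡ 64 * (e * e)
    regroup = solve-∀

  -- `w` bounds the error at stage 0 and is also the additive loss of each reflection. The factor 8
  -- pays for the one stage between the largest centre below `x` and the first centre not below it.
  √-constant : ℕ → ℕ
  √-constant κ = 8 * w * (8 * w) where w = 2 * κ + 2

  module Palindromic (f : ℕ → ℕ) where

    stage : ℕ → ℕ → Bool
    stage zero    = greedyBit f
    stage (suc k) = reflect (centre k) (stage k)

    -- As `x < centre x`, no reflection from stage `x` on affects `x`, so the diagonal gives the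
    -- eventual value.
    limit : ℕ → Bool
    limit x = stage x x

    stage-stable : ∀ j {k x} → 0 < x → x ≤ centre k → stage (j + k) x ≡ stage k x
    stage-stable zero    0<x x≤c = refl
    stage-stable (suc j) {k} 0<x x≤c = trans
      (reflect-below (centre (j + k)) (stage (j + k)) 0<x (≤-trans x≤c (centre-mono (m≤n+m k j))))
      (stage-stable j 0<x x≤c)

    limit-stage : ∀ k {x} → 0 < x → x ≤ centre k → limit x ≡ stage k x
    limit-stage k {x} 0<x x≤c with ≤-total k x
    ... | inj₁ k≤x = subst (λ n → stage n x ≡ stage k x) (m∸n+n≡m k≤x) (stage-stable (x ∸ k) 0<x x≤c)
    ... | inj₂ x≤k = sym (subst (λ n → stage n x ≡ stage x x) (m∸n+n≡m x≤k) (stage-stable (k ∸ x) 0<x (<⇒≤ (n<centre x))))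

    limit-symmetric : ∀ k {x y} → 0 < x → 0 < y → x + y ≡ centre k + centre k → limit x ≡ limit y
    limit-symmetric k {x} {y} 0<x 0<y x+y≡2c = begin
      limit x          ≡⟨ limit-stage (suc k) 0<x (≤-trans (≤-trans (m≤m+n x y) (≤-reflexive x+y≡2c)) 2c≤) ⟩
      stage (suc k) x  ≡⟨ reflect-symmetric (centre k) (stage k) 0<x 0<y x+y≡2c ⟩
      stage (suc k) y  ≡⟨ limit-stage (suc k) 0<y (≤-trans (≤-trans (m≤n+m y x) (≤-reflexive x+y≡2c)) 2c≤) ⟨
      limit y          ∎
      where
      open ≡-Reasoning
      2c≤ : centre k + centre k ≤ centre (suc k)
      2c≤ = <⇒≤ (2centre<centre k)

    limit-pair : ∀ k {x} → centre k + centre k ≤ x → x ≤ suc (centre k + centre k) → limit x ≡ true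
    limit-pair k 2c≤x x≤ = trans
      (limit-stage (suc k) (<-≤-trans (<-≤-trans (centre>0 k) (m≤m+n (centre k) (centre k))) 2c≤x) (≤-trans x≤ (2centre<centre k)))
      (reflect-pair (centre k) (stage k) 2c≤x x≤)

    module _ {κ} (f≤id : ∀ x → f x ≤ x) (add : NearlyAdditive κ f) where

      private w = 2 * κ + 2

      -- One reflection turns a bound `s` into `5 * s + w`, at most `6 * s` since `s ≥ w`. Rounding
      -- up to `8 * s` makes the square of the growth factor equal to 64, the growth factor of the
      -- centres.
      stage-close : ∀ k x → ∣ tally (stage k) x - f x ∣ ≤ w * 8 ^ k
      stage-close zero x = begin
        ∣ tally (greedyBit f) x - f x ∣ ≡⟨ cong (∣_- f x ∣) (tally-greedyBit f x) ⟩
        ∣ greedy f x - f x ∣            ≤⟨ greedy-close f≤id add x ⟩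
        κ                               ≤⟨ m≤m+n κ (κ + 2) ⟩
        κ + (κ + 2)                     ≡⟨ total κ ⟩
        w * 8 ^ 0                       ∎
        where
        open ≤-Reasoning
        total : ∀ κ → κ + (κ + 2) ≡ (2 * κ + 2) * 1
        total = solve-∀
      stage-close (suc k) x = begin
        ∣ tally (stage (suc k)) x - f x ∣ ≤⟨ reflect-close add (stage-close k) (sym (suc-pred (centre k) {{m^n≢0 64 k}})) x ⟩
        5 * (w * 8 ^ k) + w               ≤⟨ +-monoʳ-≤ (5 * (w * 8 ^ k)) (m≤m*n w (8 ^ k) {{m^n≢0 8 k}}) ⟩
        5 * (w * 8 ^ k) + w * 8 ^ k       ≤⟨ m≤m+n _ (2 * (w * 8 ^ k)) ⟩
        5 * (w * 8 ^ k) + w * 8 ^ k + 2 * (w * 8 ^ k) ≡⟨ total w (8 ^ k) ⟩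
        w * 8 ^ suc k                     ∎
        where
        open ≤-Reasoning
        total : ∀ w e → 5 * (w * e) + w * e + 2 * (w * e) ≡ w * (8 * e)
        total = solve-∀

      gap : ℕ → ℕ
      gap x = ∣ tally limit x - f x ∣

      gap-stage : ∀ k {x} → x ≤ centre k → gap x ≤ w * 8 ^ k
      gap-stage k {x} x≤c = ≤-trans
        (≤-reflexive (cong (∣_- f x ∣) (tally-cong x λ 0<y y≤x → limit-stage k 0<y (≤-trans y≤x x≤c))))
        (stage-close k x)

      -- Each stage multiplies the error by 8 and the centre by 64 = 8².
      gap² : ∀ x → gap x * gap x ≤ √-constant κ * x
      gap² zero    rewrite n≤0⇒n≡0 (f≤id 0) = z≤n
      gap² x@(suc _) = upTo-centre x (<⇒≤ (n<centre x))
        where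
        open ≤-Reasoning
        -- Descends from `k = x` to the first centre not below `x`. Unless this is `centre 0`, the
        -- preceding centre is below `x`, which bounds the square of `8 ^ k` by `x`.
        upTo-centre : ∀ k → x ≤ centre k → gap x * gap x ≤ 8 * w * (8 * w) * x
        upTo-centre zero x≤1 = begin
          gap x * gap x          ≤⟨ *-mono-≤ gap≤ gap≤ ⟩
          8 * w * (8 * w)        ≤⟨ m≤m*n (8 * w * (8 * w)) x ⟩
          8 * w * (8 * w) * x    ∎
          where
          gap≤ : gap x ≤ 8 * w
          gap≤ = ≤-trans (gap-stage 0 x≤1) (≤-trans (≤-reflexive (*-identityʳ w)) (m≤n*m w 8))
        upTo-centre (suc k) x≤c with x ≤? centre k
        ... | yes x≤c′ = upTo-centre k x≤c′
        ... | no  x≰c′ = begin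
          gap x * gap x                              ≤⟨ *-mono-≤ (gap-stage (suc k) x≤c) (gap-stage (suc k) x≤c) ⟩
          w * 8 ^ suc k * (w * 8 ^ suc k)            ≡⟨ regroup w (8 ^ k) ⟩
          8 * w * (8 * w) * (8 ^ k * 8 ^ k)          ≡⟨ cong (8 * w * (8 * w) *_) (8^k*8^k≡64^k k) ⟩
          8 * w * (8 * w) * centre k                 ≤⟨ *-monoʳ-≤ (8 * w * (8 * w)) (<⇒≤ (≰⇒> x≰c′)) ⟩
          8 * w * (8 * w) * x                        ∎
          where
          regroup : ∀ w e → w * (8 * e) * (w * (8 * e)) ≡ 8 * w * (8 * w) * (e * e)
          regroup = solve-∀

  m²≤n²⇒m≤n : ∀ {m n} → m * m ≤ n * n → m ≤ n
  m²≤n²⇒m≤n m²≤n² = ≮⇒≥ λ n<m → <⇒≱ (*-mono-< n<m n<m) m²≤n²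

  -- The two terms of the threshold each control one half: the first gives (2dj)² ≤ 4j²cx ≤ x², the
  -- second gives 10j ≤ x. With `j` at least 1/ε this makes `d + 5` at most εx; the 5 is room for
  -- rounding in the density estimate.
  √-sublinear : ∀ {c} j {d x} → d * d ≤ c * x → 4 * (j * j) * c + 10 * j ≤ x → (d + 5) * j ≤ x
  √-sublinear {c} j {d} {x} d²≤cx big = *-cancelˡ-≤ 2 (begin
    2 * ((d + 5) * j)       ≡⟨ split d j ⟩
    2 * (d * j) + 10 * j     ≤⟨ +-mono-≤ (m²≤n²⇒m≤n {2 * (d * j)} square) (≤-trans (m≤n+m (10 * j) (4 * (j * j) * c)) big) ⟩
    x + x                   ≡⟨ cong (x +_) (+-identityʳ x) ⟨
    2 * x                   ∎)
    where
    open ≤-Reasoning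
    split : ∀ d j → 2 * ((d + 5) * j) ≡ 2 * (d * j) + 10 * j
    split = solve-∀
    square : 2 * (d * j) * (2 * (d * j)) ≤ x * x
    square = begin
      2 * (d * j) * (2 * (d * j))   ≡⟨ regroup d j ⟩
      4 * (j * j) * (d * d)         ≤⟨ *-monoʳ-≤ (4 * (j * j)) d²≤cx ⟩
      4 * (j * j) * (c * x)         ≡⟨ *-assoc (4 * (j * j)) c x ⟨
      4 * (j * j) * c * x           ≤⟨ *-monoˡ-≤ x (≤-trans (m≤m+n (4 * (j * j) * c) (10 * j)) big) ⟩
      x * x                         ∎
      where
      regroup : ∀ d j → 2 * (d * j) * (2 * (d * j)) ≡ 4 * (j * j) * (d * d)
      regroup = solve-∀

  -- Increasing enumeration of an unbounded set

  module Enumeration (b : ℕ → Bool) (unbounded : ∀ n → ∃[ x ] n < x × b x ≡ true) where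

    IsNext : ℕ → ℕ → Set
    IsNext n x = n < x × b x ≡ true × (∀ {y} → n < y → b y ≡ true → x ≤ y)

    -- The recursion is on `d`, the distance from `suc n` to a member `x` already known.
    search : ∀ d n {x} → suc n + d ≡ x → b x ≡ true → ∃ (IsNext n)
    search d n refl bx with b (suc n) in eq
    ... | true  = suc n , n<1+n n , eq , λ n<y _ → n<y
    search zero n refl bx | false = contradiction (trans (sym (trans (cong b (sym (+-identityʳ (suc n)))) bx)) eq) λ ()
    search (suc d) n refl bx | false with search d (suc n) (sym (+-suc (suc n) d)) bx
    ... | x , n<x , bx′ , least = x , <-trans (n<1+n n) n<x , bx′ , least′
      where
      least′ : ∀ {y} → n < y → b y ≡ true → x ≤ y
      least′ {y} n<y by with m≤n⇒m<n∨m≡n n<y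
      ... | inj₁ 1+n<y = least 1+n<y by
      ... | inj₂ refl  = contradiction (trans (sym by) eq) λ ()

    next : ∀ n → ∃ (IsNext n)
    next n with unbounded n
    ... | x , n<x , bx = search (x ∸ suc n) n (m+[n∸m]≡n n<x) bx

    enum : ℕ → ℕ
    enum zero    = proj₁ (next 0)
    enum (suc i) = proj₁ (next (enum i))

    enum-increasing : StrictlyIncreasing enum
    enum-increasing i = proj₁ (proj₂ (next (enum i)))

    enum-positive : AllPositive enum
    enum-positive zero    = proj₁ (proj₂ (next 0))
    enum-positive (suc i) = ≤-<-trans z≤n (enum-increasing i)

    enum-true : ∀ i → b (enum i) ≡ true
    enum-true zero    = proj₁ (proj₂ (proj₂ (next 0)))
    enum-true (suc i) = proj₁ (proj₂ (proj₂ (next (enum i))))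

    enum-least : ∀ i {y} → enum i < y → b y ≡ true → enum (suc i) ≤ y
    enum-least i = proj₂ (proj₂ (proj₂ (next (enum i))))

    -- Since `x ≤ enum x`, a descent from index `x` finds the first term that is not below `x`; as
    -- the enumeration skips no member, that term is `x`.
    true⇒Range : ∀ {x} → 0 < x → b x ≡ true → Range enum x
    true⇒Range {x} 0<x bx = below x (index≤term enum-increasing x)
      where
      below : ∀ i → x ≤ enum i → Range enum x
      below zero    x≤a = 0 , ≤-antisym (proj₂ (proj₂ (proj₂ (next 0))) 0<x bx) x≤a
      below (suc i) x≤a with x ≤? enum i
      ... | yes x≤a′ = below i x≤a′
      ... | no  x≰a′ = suc i , ≤-antisym (enum-least i (≰⇒> x≰a′) bx) x≤a

    Range⇒true : ∀ {x} → Range enum x → b x ≡ true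
    Range⇒true (i , refl) = enum-true i

    Range-positive : ∀ {x} → Range enum x → 0 < x
    Range-positive (i , refl) = enum-positive i

    enum-twins : ∀ {x} → 0 < x → b x ≡ true → b (suc x) ≡ true →
                 ∃[ i ] enum i ≡ x × enum (suc i) ≡ suc x
    enum-twins 0<x bx b1+x with true⇒Range 0<x bx
    ... | i , refl = i , refl , ≤-antisym (enum-least i (n<1+n (enum i)) b1+x) (enum-increasing i)

    Range-resp : ∀ {x y} → 0 < y → b x ≡ b y → Range enum x → Range enum y
    Range-resp 0<y bx≡by x∈A = true⇒Range 0<y (trans (sym bx≡by) (Range⇒true x∈A))

  -- Agreement of `count` with `tally`

  count-suc : ∀ {A : Pred ℕ 0ℓ} (A? : Decidable A) n →
              count A? (suc n) ≡ count A? n + bit (does (A? (suc n)))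
  count-suc A? n = begin
    length (filter A? (map suc (upTo (suc n))))
      ≡⟨ cong (λ xs → length (filter A? (map suc xs))) (upTo-∷ʳ n) ⟨
    length (filter A? (map suc (upTo n ∷ʳ n)))
      ≡⟨ cong (λ xs → length (filter A? xs)) (map-++ suc (upTo n) (n ∷ [])) ⟩
    length (filter A? (map suc (upTo n) ∷ʳ suc n))
      ≡⟨ cong length (filter-++ A? (map suc (upTo n)) (suc n ∷ [])) ⟩
    length (filter A? (map suc (upTo n)) ++ filter A? (suc n ∷ []))
      ≡⟨ length-++ (filter A? (map suc (upTo n))) ⟩
    count A? n + length (filter A? (suc n ∷ []))
      ≡⟨ cong (count A? n +_) last ⟩
    count A? n + bit (does (A? (suc n))) ∎
    where
    open ≡-Reasoning
    last : length (filter A? (suc n ∷ [])) ≡ bit (does (A? (suc n)))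
    last with does (A? (suc n))
    ... | true  = refl
    ... | false = refl

  count≡tally : ∀ {A : Pred ℕ 0ℓ} (A? : Decidable A) {b} →
                (∀ {x} → 0 < x → does (A? x) ≡ b x) → ∀ n → count A? n ≡ tally b n
  count≡tally A? A?≗b zero    = refl
  count≡tally A? A?≗b (suc n) =
    trans (count-suc A? n) (cong₂ (λ c v → c + bit v) (count≡tally A? A?≗b n) (A?≗b z<s))

  module _ {b : ℕ → Bool} {unbounded : ∀ n → ∃[ x ] n < x × b x ≡ true} where
    open Enumeration b unbounded

    range?≗b : ∀ {x} → 0 < x → does (range? enum-increasing x) ≡ b x
    range?≗b {x} 0<x with b x in bx
    ... | true  = dec-true (range? enum-increasing x) (true⇒Range 0<x bx)
    ... | false = dec-false (range? enum-increasing x) λ x∈A → contradiction (trans (sym (Range⇒true x∈A)) bx) λ ()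

-- Rational approximation and the density

open import Data.Integer.Base as ℤ using (+_; -[1+_]; +≤+; +<+)
import Data.Integer.Properties as ℤ
open import Data.Rational.Unnormalised.Base
open import Data.Rational.Unnormalised.Properties
open import Data.Rational.Unnormalised.Solver using (module +-*-Solver)
open +-*-Solver using (solve; _:=_; _:+_; _:*_; _:-_; con)

ι : ℕ → ℚᵘ
ι n = + n / 1

ι-mono : ∀ {m n} → m ℕ.≤ n → ι m ≤ ι n
ι-mono m≤n = *≤* (ℤ.*-monoʳ-≤-nonNeg (+ 1) (+≤+ m≤n))

ι-mono-< : ∀ {m n} → m ℕ.< n → ι m < ι n
ι-mono-< m<n = *<* (ℤ.*-monoʳ-<-pos (+ 1) (+<+ m<n))

ι-cancel : ∀ {m n} → ι m ≤ ι n → m ℕ.≤ n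
ι-cancel {m} {n} (*≤* le) = ℤ.drop‿+≤+ (ℤ.*-cancelʳ-≤-pos (+ m) (+ n) (+ 1) le)

ι-+ : ∀ m n → ι (m ℕ.+ n) ≃ ι m + ι n
ι-+ m n = *≡* (cong (ℤ._* + 1) (sym (cong₂ ℤ._+_ (ℤ.*-identityʳ (+ m)) (ℤ.*-identityʳ (+ n)))))

ι-* : ∀ m n → ι (m ℕ.* n) ≃ ι m * ι n
ι-* m n = *≡* (cong (ℤ._* + 1) (ℤ.pos-* m n))

*-/ : ∀ n d .{{_ : ℕ.NonZero d}} → ι d * (+ n / d) ≃ ι n
*-/ n (suc d) = *≡* (trans (ℤ.*-identityʳ _) (trans (ℤ.*-comm (+ suc d) (+ n)) (cong (λ k → + n ℤ.* + suc k) (sym (ℕ.+-identityʳ d)))))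

p≤∣p∣ : ∀ p → p ≤ ∣ p ∣
p≤∣p∣ p with ≤-total p 0ℚᵘ
... | inj₁ p≤0 = ≤-trans p≤0 (0≤∣p∣ p)
... | inj₂ 0≤p = ≤-reflexive (≃-sym (0≤p⇒∣p∣≃p 0≤p))

*-/suc≤ : ∀ k x → ι x * (+ k / suc x) ≤ ι k
*-/suc≤ k x = ≤-trans (*-monoˡ-≤-nonNeg (+ k / suc x) (ι-mono (ℕ.n≤1+n x))) (≤-reflexive (*-/ k (suc x)))

-- The denominator of `ε` serves as `j`: the product is then the numerator, which is at least 1.
archimedean : ∀ {ε} → 0ℚᵘ < ε → ∃[ j ] 1ℚᵘ ≤ ι j * ε
archimedean {ε@(mkℚᵘ (+ suc p) q)} 0<ε = suc q , (begin
  1ℚᵘ                      ≤⟨ ι-mono (s≤s z≤n) ⟩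
  ι (suc p)                ≃⟨ *-/ (suc p) (suc q) ⟨
  ι (suc q) * ε            ∎)
  where open ≤-Reasoning
archimedean {mkℚᵘ (+ 0) q} (*<* (+<+ ()))
archimedean {mkℚᵘ -[1+ p ] q} (*<* ())

-- The floor of q, truncated to {0,…,n}.
clampedFloor : ℕ → ℚᵘ → ℕ
clampedFloor zero    q = 0
clampedFloor (suc n) q = if does (ι (suc n) ≤? q) then suc n else clampedFloor n q

clampedFloor≤ : ∀ n q → clampedFloor n q ℕ.≤ n
clampedFloor≤ zero    q = z≤n
clampedFloor≤ (suc n) q with does (ι (suc n) ≤? q)
... | true  = ℕ.≤-refl
... | false = ℕ.m≤n⇒m≤1+n (clampedFloor≤ n q)

-- The slack of 2 is there because an approximation to a nonnegative real may be negative: its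
-- multiple `q` can reach -2, where the truncated value is 0. The lower bound allows the same excess
-- above `n`.
clampedFloor-upper : ∀ n {q} → 0ℚᵘ ≤ q + ι 2 → ι (clampedFloor n q) ≤ q + ι 2
clampedFloor-upper zero    0≤q+2 = 0≤q+2
clampedFloor-upper (suc n) {q} 0≤q+2 with ι (suc n) ≤? q
... | yes n<q rewrite dec-true (ι (suc n) ≤? q) n<q = ≤-trans n<q (p≤p+q q (ι 2))
... | no  n≮q rewrite dec-false (ι (suc n) ≤? q) n≮q = clampedFloor-upper n 0≤q+2

clampedFloor-lower : ∀ n {q} → q ≤ ι n + ι 2 → q ≤ ι (clampedFloor n q) + ι 2
clampedFloor-lower zero    q≤n+2 = q≤n+2
clampedFloor-lower (suc n) {q} q≤n+2 with ι (suc n) ≤? q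
... | yes n<q rewrite dec-true (ι (suc n) ≤? q) n<q = q≤n+2
... | no  n≮q rewrite dec-false (ι (suc n) ≤? q) n≮q = clampedFloor-lower n (begin
  q              ≤⟨ ≰⇒≥ n≮q ⟩
  ι (suc n)      ≤⟨ ι-mono (ℕ.≤-trans (ℕ.n≤1+n (suc n)) (ℕ.≤-reflexive (ℕ.+-comm 2 n))) ⟩
  ι (n ℕ.+ 2)    ≃⟨ ι-+ n 2 ⟩
  ι n + ι 2      ∎)
  where open ≤-Reasoning

-- Rounded multiples of a real in the unit interval

module _ (α : ℝ) where

  multiple : ℕ → ℚᵘ
  multiple x = ι x * approx α x

  approx-close : ∀ x y → approx α x ≤ approx α y + ((+ 1 / suc x) + (+ 1 / suc y))
  approx-close x y = begin
    approx α x                               ≃⟨ solve 2 (λ p q → p := q :+ (p :- q)) ≃-refl (approx α x) (approx α y) ⟩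
    approx α y + (approx α x - approx α y)   ≤⟨ +-monoʳ-≤ (approx α y) (≤-trans (p≤∣p∣ _) (regular α x y)) ⟩
    approx α y + ((+ 1 / suc x) + (+ 1 / suc y)) ∎
    where open ≤-Reasoning

  -- This is regularity multiplied by xy, with x/(x+1) and y/(y+1) bounded by 1.
  multiple-quasiLinear : ∀ x y → ι y * multiple x ≤ ι x * multiple y + (ι x + ι y)
  multiple-quasiLinear x y = begin
    ι y * (ι x * approx α x)
      ≤⟨ *-monoʳ-≤-nonNeg (ι y) (*-monoʳ-≤-nonNeg (ι x) (approx-close x y)) ⟩
    ι y * (ι x * (approx α y + ((+ 1 / suc x) + (+ 1 / suc y))))
      ≃⟨ solve 5 (λ x y a u v → y :* (x :* (a :+ (u :+ v))) := x :* (y :* a) :+ (x :* (y :* v) :+ y :* (x :* u)))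
           ≃-refl (ι x) (ι y) (approx α y) (+ 1 / suc x) (+ 1 / suc y) ⟩
    ι x * multiple y + (ι x * (ι y * (+ 1 / suc y)) + ι y * (ι x * (+ 1 / suc x)))
      ≤⟨ +-monoʳ-≤ (ι x * multiple y) (+-mono-≤ (*-monoʳ-≤-nonNeg (ι x) (*-/suc≤ 1 y)) (*-monoʳ-≤-nonNeg (ι y) (*-/suc≤ 1 x))) ⟩
    ι x * multiple y + (ι x * 1ℚᵘ + ι y * 1ℚᵘ)
      ≃⟨ +-congʳ (ι x * multiple y) (+-cong (*-identityʳ (ι x)) (*-identityʳ (ι y))) ⟩
    ι x * multiple y + (ι x + ι y) ∎
    where open ≤-Reasoning

  floorMultiple : ℕ → ℕ
  floorMultiple x = clampedFloor x (multiple x)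

  floorMultiple≤ : ∀ x → floorMultiple x ℕ.≤ x
  floorMultiple≤ x = clampedFloor≤ x (multiple x)

  floorMultiple-upper : 0ℝ ≤ᴿ α → ∀ x → ι (floorMultiple x) ≤ multiple x + ι 2
  floorMultiple-upper 0≤α x = clampedFloor-upper x (begin
    0ℚᵘ                                        ≃⟨ *-zeroʳ (ι x) ⟨
    -- Were `approx α x + 2/(x+1)` negative, the index `x` would witness `α <ᴿ 0ℝ`.
    ι x * 0ℚᵘ                                  ≤⟨ *-monoʳ-≤-nonNeg (ι x) (≮⇒≥ λ lt → 0≤α (x , lt)) ⟩
    ι x * (approx α x + (+ 2 / suc x))         ≃⟨ *-distribˡ-+ (ι x) (approx α x) (+ 2 / suc x) ⟩
    multiple x + ι x * (+ 2 / suc x)           ≤⟨ +-monoʳ-≤ (multiple x) (*-/suc≤ 2 x) ⟩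
    multiple x + ι 2                           ∎)
    where open ≤-Reasoning

  floorMultiple-lower : α ≤ᴿ 1ℝ → ∀ x → multiple x ≤ ι (floorMultiple x) + ι 2
  floorMultiple-lower α≤1 x = clampedFloor-lower x (begin
    ι x * approx α x                           ≤⟨ *-monoʳ-≤-nonNeg (ι x) (≮⇒≥ λ lt → α≤1 (x , lt)) ⟩
    ι x * (1ℚᵘ + (+ 2 / suc x))                ≃⟨ *-distribˡ-+ (ι x) 1ℚᵘ (+ 2 / suc x) ⟩
    ι x * 1ℚᵘ + ι x * (+ 2 / suc x)            ≤⟨ +-mono-≤ (≤-reflexive (*-identityʳ (ι x))) (*-/suc≤ 2 x) ⟩
    ι x + ι 2                                  ∎)
    where open ≤-Reasoning

  -- The 3 collects 2y and 2x from the two roundings and x + y from the regularity of `α`.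
  floorMultiple-quasiLinear : 0ℝ ≤ᴿ α → α ≤ᴿ 1ℝ → QuasiLinear 3 floorMultiple
  floorMultiple-quasiLinear 0≤α α≤1 x y = ι-cancel (begin
    ι (y ℕ.* f x)                                    ≃⟨ ι-* y (f x) ⟩
    ι y * ι (f x)                                    ≤⟨ *-monoʳ-≤-nonNeg (ι y) (floorMultiple-upper 0≤α x) ⟩
    ι y * (multiple x + ι 2)                         ≃⟨ *-distribˡ-+ (ι y) (multiple x) (ι 2) ⟩
    ι y * multiple x + ι y * ι 2                     ≤⟨ +-monoˡ-≤ (ι y * ι 2) (multiple-quasiLinear x y) ⟩
    ι x * multiple y + (ι x + ι y) + ι y * ι 2       ≤⟨ +-monoˡ-≤ (ι y * ι 2) (+-monoˡ-≤ (ι x + ι y) (*-monoʳ-≤-nonNeg (ι x) (floorMultiple-lower α≤1 y))) ⟩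
    ι x * (ι (f y) + ι 2) + (ι x + ι y) + ι y * ι 2  ≃⟨ solve 3 (λ x y v → x :* (v :+ con (ι 2)) :+ (x :+ y) :+ y :* con (ι 2) := x :* v :+ con (ι 3) :* (x :+ y)) ≃-refl (ι x) (ι y) (ι (f y)) ⟩
    ι x * ι (f y) + ι 3 * (ι x + ι y)                ≃⟨ +-congʳ (ι x * ι (f y)) (*-congˡ {ι 3} (ι-+ x y)) ⟨
    ι x * ι (f y) + ι 3 * ι (x ℕ.+ y)                ≃⟨ +-cong (ι-* x (f y)) (ι-* 3 (x ℕ.+ y)) ⟨
    ι (x ℕ.* f y) + ι (3 ℕ.* (x ℕ.+ y))              ≃⟨ ι-+ (x ℕ.* f y) (3 ℕ.* (x ℕ.+ y)) ⟨
    ι (x ℕ.* f y ℕ.+ 3 ℕ.* (x ℕ.+ y))                ∎)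
    where
    open ≤-Reasoning
    f = floorMultiple

ι≤ι*ε : ∀ {ε} → 0ℚᵘ < ε → ∀ {j} → 1ℚᵘ ≤ ι j * ε → ∀ {m x} → m ℕ.* j ℕ.≤ x → ι m ≤ ι x * ε
ι≤ι*ε {ε} 0<ε {j} 1≤jε {m} {x} mj≤x = begin
  ι m                ≃⟨ *-identityʳ (ι m) ⟨
  ι m * 1ℚᵘ          ≤⟨ *-monoʳ-≤-nonNeg (ι m) 1≤jε ⟩
  ι m * (ι j * ε)    ≃⟨ *-assoc (ι m) (ι j) ε ⟨
  ι m * ι j * ε      ≃⟨ *-congʳ {ε} (ι-* m j) ⟨
  ι (m ℕ.* j) * ε    ≤⟨ *-monoˡ-≤-nonNeg ε {{nonNegative (<⇒≤ 0<ε)}} (ι-mono mj≤x) ⟩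
  ι x * ε            ∎
  where open ≤-Reasoning

-- Convergence of the counting quotients

module _ (α : ℝ) {c d n : ℕ} {ε : ℚᵘ} (large : ι (d ℕ.+ 5) ≤ ι (suc n) * ε) where

  private x = suc n

  -- Scaled by `x`, the 5 in `large` splits into 2 for the rounding of `f`, 2 for the margin that
  -- `<ᴿ` demands at index `x`, and 1 for strictness. The same split serves `above-limit`.
  below-limit : ι c ≤ multiple α x + ι 2 + ι d → fromℚ (+ c / x - ε) <ᴿ α
  below-limit c≤ = x , *-cancelˡ-<-nonNeg (ι x) (begin-strict
    ι x * ((+ c / x - ε) + (+ 2 / suc x))
      ≃⟨ solve 4 (λ x q e s → x :* ((q :- e) :+ s) := x :* q :+ x :* s :- x :* e) ≃-refl (ι x) (+ c / x) ε (+ 2 / suc x) ⟩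
    ι x * (+ c / x) + ι x * (+ 2 / suc x) - ι x * ε
      ≤⟨ +-mono-≤ (+-mono-≤ (≤-trans (≤-reflexive (*-/ c x)) c≤) (*-/suc≤ 2 x)) (neg-mono-≤ large) ⟩
    multiple α x + ι 2 + ι d + ι 2 - ι (d ℕ.+ 5)
      ≃⟨ +-congʳ (multiple α x + ι 2 + ι d + ι 2) (-‿cong (ι-+ d 5)) ⟩
    multiple α x + ι 2 + ι d + ι 2 - (ι d + ι 5)
      ≃⟨ solve 2 (λ r d → r :+ con (ι 2) :+ d :+ con (ι 2) :- (d :+ con (ι 5)) := r :- con (ι 1)) ≃-refl (multiple α x) (ι d) ⟩
    multiple α x - ι 1
      <⟨ +-monoʳ-< (multiple α x) (neg-mono-< (ι-mono-< z<s)) ⟩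
    multiple α x + 0ℚᵘ
      ≃⟨ +-identityʳ (multiple α x) ⟩
    multiple α x ∎)
    where open ≤-Reasoning

  above-limit : multiple α x ≤ ι c + ι d + ι 2 → α <ᴿ fromℚ (+ c / x + ε)
  above-limit ≤c = x , *-cancelˡ-<-nonNeg (ι x) (begin-strict
    ι x * (approx α x + (+ 2 / suc x))
      ≃⟨ *-distribˡ-+ (ι x) (approx α x) (+ 2 / suc x) ⟩
    multiple α x + ι x * (+ 2 / suc x)
      ≤⟨ +-mono-≤ ≤c (*-/suc≤ 2 x) ⟩
    ι c + ι d + ι 2 + ι 2
      ≃⟨ solve 2 (λ c d → c :+ d :+ con (ι 2) :+ con (ι 2) := c :+ (d :+ con (ι 4))) ≃-refl (ι c) (ι d) ⟩
    ι c + (ι d + ι 4)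
      <⟨ +-monoʳ-< (ι c) (+-monoʳ-< (ι d) (ι-mono-< (ℕ.n<1+n 4))) ⟩
    ι c + (ι d + ι 5)
      ≃⟨ +-cong (*-/ c x) (ι-+ d 5) ⟨
    ι x * (+ c / x) + ι (d ℕ.+ 5)
      ≤⟨ +-monoʳ-≤ (ι x * (+ c / x)) large ⟩
    ι x * (+ c / x) + ι x * ε
      ≃⟨ *-distribˡ-+ (ι x) (+ c / x) ε ⟨
    ι x * (+ c / x + ε) ∎)
    where open ≤-Reasoning

tally-density : ∀ α (f : ℕ → ℕ) (b : ℕ → Bool) c →
  (∀ x → ι (f x) ≤ multiple α x + ι 2) → (∀ x → multiple α x ≤ ι (f x) + ι 2) →
  (∀ x → ℕ.∣ tally b x - f x ∣ ℕ.* ℕ.∣ tally b x - f x ∣ ℕ.≤ c ℕ.* x) →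
  ∀ {A : Pred ℕ 0ℓ} (A? : Decidable A) → (∀ {x} → 0 ℕ.< x → does (A? x) ≡ b x) → HasDensity A? α
tally-density α f b c f-upper f-lower gap² A? A?≗b ε 0<ε with archimedean 0<ε
-- The threshold is that of `√-sublinear`, which bounds `d + 5` by εx through `1 ≤ j * ε`.
... | j , 1≤jε = 4 ℕ.* (j ℕ.* j) ℕ.* c ℕ.+ 10 ℕ.* j , λ n N≤n →
  let
    x = suc n
    d = ℕ.∣ tally b x - f x ∣
    large : ι (d ℕ.+ 5) ≤ ι x * ε
    large = ι≤ι*ε 0<ε {j} 1≤jε (√-sublinear {c} j {d} {x} (gap² x) (ℕ.≤-trans N≤n (ℕ.n≤1+n n)))
    count≤ : ι (count A? x) ≤ ι (f x) + ι d
    count≤ = ≤-trans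
      (ι-mono (subst (λ t → t ℕ.≤ f x ℕ.+ d) (sym (count≡tally A? A?≗b x)) (ℕ.m≤n+∣m-n∣ (tally b x) (f x))))
      (≤-reflexive (ι-+ (f x) d))
    ≤count : ι (f x) ≤ ι (count A? x) + ι d
    ≤count = ≤-trans
      (ι-mono (subst (λ t → f x ℕ.≤ t ℕ.+ d) (sym (count≡tally A? A?≗b x)) (ℕ.m≤n+∣n-m∣ (f x) (tally b x))))
      (≤-reflexive (ι-+ (count A? x) d))
  in
  below-limit α {count A? x} {d} {n} {ε} large (≤-trans count≤ (+-monoˡ-≤ (ι d) (f-upper x))) ,
  above-limit α {count A? x} {d} {n} {ε} large (≤-trans (f-lower x) (+-monoˡ-≤ (ι 2) ≤count))

-- The limit inferior of the ratios

<ᴿ-irrefl : ∀ {q r} → r ≤ q → ¬ (fromℚ q <ᴿ fromℚ r)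
<ᴿ-irrefl {q} {r} r≤q (n , q+2/n<r) = <-irrefl ≃-refl (<-≤-trans q+2/n<r (≤-trans r≤q (p≤p+q q (+ 2 / suc n))))

module _ {a : ℕ → ℕ} (pos : AllPositive a) (inc : StrictlyIncreasing a) where

  ratio≥1 : ∀ i → 1ℚᵘ ≤ ratio a pos i
  ratio≥1 i = *-cancelˡ-≤-pos (ι (a i)) {{positive (ι-mono-< (pos i))}} (begin
    ι (a i) * 1ℚᵘ          ≃⟨ *-identityʳ (ι (a i)) ⟩
    ι (a i)                ≤⟨ ι-mono (ℕ.<⇒≤ (inc i)) ⟩
    ι (a (suc i))          ≃⟨ *-/ (a (suc i)) (a i) {{ℕ.>-nonZero (pos i)}} ⟨
    ι (a i) * ratio a pos i ∎)
    where open ≤-Reasoning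

  monotone : ∀ {i j} → i ℕ.≤ j → a i ℕ.≤ a j
  monotone {i} i≤j = subst (λ k → a i ℕ.≤ a k) (ℕ.m∸n+n≡m i≤j) (go (_ ℕ.∸ i))
    where
    go : ∀ d → a i ℕ.≤ a (d ℕ.+ i)
    go zero    = ℕ.≤-refl
    go (suc d) = ℕ.≤-trans (go d) (ℕ.<⇒≤ (inc (d ℕ.+ i)))

  -- Every tail has infimum 1: no ratio is below 1, and a twin pair at `x` has ratio 1 + 1/x, with
  -- `x` as large as desired. The supremum is then that of a constant sequence.
  liminf-ratio : (∀ N → ∃[ i ] ∃[ x ] N ℕ.≤ x × a i ≡ x × a (suc i) ≡ suc x) → IsLimInf (ratio a pos) 1ℝ
  liminf-ratio twins =
    (λ _ → 1ℝ) ,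
    (λ N → (λ i → <ᴿ-irrefl (ratio≥1 (N ℕ.+ i))) , beaten N) ,
    (λ _ → <ᴿ-irrefl ≤-refl) ,
    λ y y<1 → 0 , y<1
    where
    beaten : ∀ N y → 1ℝ <ᴿ y → ∃[ k ] fromℚ (ratio a pos (N ℕ.+ k)) <ᴿ y
    beaten N y (n , 1+δ<y) = i ℕ.∸ N , n ,
      subst (λ i → ratio a pos i + δ < approx y n) (sym (ℕ.m+[n∸m]≡n N≤i)) close
      where
      open ≤-Reasoning
      δ = + 2 / suc n
      ε = approx y n - (1ℚᵘ + δ)
      0<ε : 0ℚᵘ < ε
      0<ε = begin-strict
        0ℚᵘ                          ≃⟨ +-inverseʳ (1ℚᵘ + δ) ⟨
        (1ℚᵘ + δ) - (1ℚᵘ + δ)        <⟨ +-monoˡ-< (- (1ℚᵘ + δ)) 1+δ<y ⟩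
        ε                            ∎
      j = proj₁ (archimedean 0<ε)
      -- The summand `a N` forces the index of the twin to be at least `N`. The summand `j * 2`
      -- makes `a i * ε` at least 2, more than the gap of 1 between the twins.
      twin = twins (suc (a N ℕ.+ j ℕ.* 2))
      i = proj₁ twin
      large : suc (a N ℕ.+ j ℕ.* 2) ℕ.≤ a i
      large = let _ , _ , N≤x , ai≡x , _ = twin in ℕ.≤-trans N≤x (ℕ.≤-reflexive (sym ai≡x))
      consecutive : a (suc i) ≡ suc (a i)
      consecutive = let _ , _ , _ , ai≡x , a1+i≡1+x = twin in trans a1+i≡1+x (cong suc (sym ai≡x))
      N≤i : N ℕ.≤ i
      N≤i = ℕ.≮⇒≥ λ i<N → ℕ.<⇒≱ large (ℕ.≤-trans (monotone (ℕ.<⇒≤ i<N)) (ℕ.m≤m+n (a N) (j ℕ.* 2)))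
      2j≤ai : 2 ℕ.* j ℕ.≤ a i
      2j≤ai = ℕ.≤-trans (ℕ.≤-reflexive (ℕ.*-comm 2 j)) (ℕ.≤-trans (ℕ.m≤n+m (j ℕ.* 2) (suc (a N))) large)
      close : ratio a pos i + δ < approx y n
      close = *-cancelˡ-<-nonNeg (ι (a i)) (begin-strict
        ι (a i) * (ratio a pos i + δ)          ≃⟨ *-distribˡ-+ (ι (a i)) (ratio a pos i) δ ⟩
        ι (a i) * ratio a pos i + ι (a i) * δ  ≃⟨ +-congˡ (ι (a i) * δ) (*-/ (a (suc i)) (a i) {{ℕ.>-nonZero (pos i)}}) ⟩
        ι (a (suc i)) + ι (a i) * δ            ≡⟨ cong (λ m → ι m + ι (a i) * δ) consecutive ⟩
        ι (1 ℕ.+ a i) + ι (a i) * δ            ≃⟨ +-congˡ (ι (a i) * δ) (ι-+ 1 (a i)) ⟩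
        ι 1 + ι (a i) + ι (a i) * δ            <⟨ +-monoˡ-< (ι (a i) * δ) (+-monoˡ-< (ι (a i)) (<-≤-trans (ι-mono-< (ℕ.n<1+n 1)) (ι≤ι*ε 0<ε (proj₂ (archimedean 0<ε)) 2j≤ai))) ⟩
        ι (a i) * ε + ι (a i) + ι (a i) * δ    ≃⟨ solve 3 (λ a y d → a :* (y :- (con 1ℚᵘ :+ d)) :+ a :+ a :* d := a :* y) ≃-refl (ι (a i)) (approx y n) δ ⟩
        ι (a i) * approx y n                   ∎)

-- Sums missed by a symmetric set, and the theorem

no-complement : ∀ {A : Pred ℕ 0ℓ} → (∀ {x} → A x → 0 ℕ.< x) →
  (∀ N → ∃[ n ] N ℕ.< n × (∀ {x y} → 0 ℕ.< y → x ℕ.+ y ≡ n → A x → A y)) →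
  ¬ (Σ[ B ∈ Pred ℕ 0ℓ ] IsAdditiveComplementInComplement A B)
no-complement {A} A⊆ℕ⁺ symmetric (B , (B⊆ℕ⁺ , xs , cover) , B⊥A)
  -- The maximum, 0 for an empty list, bounds all exceptions. A symmetric `n` beyond it is positive
  -- and missed by `A ⊕ B`, hence itself an exception.
  with symmetric (max 0 xs)
... | n , max<n , sym-n =
  ℕ.<⇒≱ max<n (lookup (xs≤max 0 xs) (cover n (ℕ.≤-<-trans z≤n max<n , n∉A⊕B)))
  where
  n∉A⊕B : ¬ (A ⊕ B) n
  n∉A⊕B (x , y , x∈A , y∈B , x+y≡n) = B⊥A (y∈B , sym-n (B⊆ℕ⁺ y∈B) x+y≡n x∈A)

corollary2p1 : (α : ℝ) → 0ℝ ≤ᴿ α → α ≤ᴿ 1ℝ →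
    Σ[ a ∈ (ℕ → ℕ) ] Σ[ pos ∈ AllPositive a ] Σ[ inc ∈ StrictlyIncreasing a ]
    HasDensity (range? inc) α
    × IsLimInf (ratio a pos) 1ℝ
    × ¬ (Σ[ B ∈ Pred ℕ 0ℓ ] IsAdditiveComplementInComplement (Range a) B)
corollary2p1 α 0≤α α≤1 =
  enum , enum-positive , enum-increasing ,
  tally-density α f limit (√-constant 9) (floorMultiple-upper α 0≤α) (floorMultiple-lower α α≤1)
    (gap² (floorMultiple≤ α) near) (range? enum-increasing) range?≗b ,
  liminf-ratio enum-positive enum-increasing twins ,
  no-complement Range-positive symmetric
  where
  f = floorMultiple α
  open Palindromic f

  k<2centre : ∀ k → k ℕ.< centre k ℕ.+ centre k
  k<2centre k = ℕ.<-≤-trans (n<centre k) (ℕ.m≤m+n (centre k) (centre k))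

  -- The smaller twin of `centre k` is a member beyond `k`.
  open Enumeration limit (λ k →
    centre k ℕ.+ centre k , k<2centre k , limit-pair k ℕ.≤-refl (ℕ.n≤1+n _))

  -- The 9 is three times the quasi-linearity constant 3, and `f 0` reduces to 0 by truncation.
  near : NearlyAdditive 9 f
  near = quasiLinear⇒nearlyAdditive {3} refl (floorMultiple-quasiLinear α 0≤α α≤1)

  twins : ∀ N → ∃[ i ] ∃[ x ] N ℕ.≤ x × enum i ≡ x × enum (suc i) ≡ suc x
  twins N = let i , ai≡x , a1+i≡1+x = enum-twins (ℕ.≤-<-trans z≤n (k<2centre N))
                  (limit-pair N ℕ.≤-refl (ℕ.n≤1+n _)) (limit-pair N (ℕ.n≤1+n _) ℕ.≤-refl)
            in i , centre N ℕ.+ centre N , ℕ.<⇒≤ (k<2centre N) , ai≡x , a1+i≡1+x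

  symmetric : ∀ N → ∃[ n ] N ℕ.< n × (∀ {x y} → 0 ℕ.< y → x ℕ.+ y ≡ n → Range enum x → Range enum y)
  symmetric N = centre N ℕ.+ centre N , k<2centre N , λ 0<y x+y≡2c x∈A →
    Range-resp 0<y (limit-symmetric N (Range-positive x∈A) 0<y x+y≡2c) x∈A
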